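{- $\mathrm{MITL}[\mathsf F_\infty,\mathsf P_\infty]\subsetneq\mathrm{MITL}[\mathsf F_{0,\infty},\mathsf P_{0,\infty}]$ in expressive power: every timed language definable in $\mathrm{MITL}[\mathsf F_\infty,\mathsf P_\infty]$ is definable in $\mathrm{MITL}[\mathsf F_{0,\infty},\mathsf P_{0,\infty}]$, and there is a timed language definable in $\mathrm{MITL}[\mathsf F_{0,\infty},\mathsf P_{0,\infty}]$ that is not definable in $\mathrm{MITL}[\mathsf F_\infty,\mathsf P_\infty]$.
   Context: Timed words: let $\Sigma$ be a finite alphabet. A timed word over $\Sigma$ is a finite nonempty sequence $\rho=(\sigma_1,\tau_1)\cdots(\sigma_n,\tau_n)$ with $\sigma_i\in\Sigma$ and real time stamps $0=\tau_1<\tau_2<\cdots<\tau_n$ (strictly monotonic time). $T\Sigma^*$ is the set of timed words over $\Sigma$. Logics: formulas are $\phi::= a\mid \phi\lor\phi\mid\neg\phi\mid \mathsf F_I\phi\mid \mathsf P_I\phi$ with $a\in\Sigma$. Semantics: $\rho,i\models a$ iff $\sigma_i=a$; Boolean connectives as usual; $\rho,i\models\mathsf F_I\phi$ iff there is $j>i$ with $\tau_j-\tau_i\in I$ and $\rho,j\models\phi$; $\rho,i\models\mathsf P_I\phi$ iff there is $j<i$ with $\tau_i-\tau_j\in I$ and $\rho,j\models\phi$. The language defined by $\phi$ is $\mathcal L(\phi)=\{\rho\in T\Sigma^*\mid\rho,1\models\phi\}$. - $\mathrm{MITL}[\mathsf F_\infty,\mathsf P_\infty]$: every $I$ is of the form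 $[l,\infty)$ or $(l,\infty)$ with $l$ a non-negative integer. - $\mathrm{MITL}[\mathsf F_{0,\infty},\mathsf P_{0,\infty}]$: every $I$ is a non-singular interval of the form $[0,u\rangle$ (i.e. $[0,u)$ or $[0,u]$) or $\langle l,\infty)$ (i.e. $(l,\infty)$ or $[l,\infty)$), with $l,u$ non-negative integers. Timed languages over all finite alphabets are considered. -}

module Defs where

open import Data.Fin as Fin using (Fin; inject₁)
open import Data.Integer as ℤ using ()
open import Data.Nat as ℕ using (ℕ; suc; _⊔_)
import Data.Nat.Properties as ℕ
open import Data.Product using (_×_; _,_; ∃; ∃-syntax)
open import Data.Rational as ℚ using (ℚ; 0ℚ; ½)
import Data.Rational.Properties as ℚ
open import Data.Rational.Solver using (module +-*-Solver)
open import Data.Sum using (_⊎_)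
open import Level using (0ℓ)
open import Relation.Binary.PropositionalEquality using (_≡_; refl; sym; trans; cong; subst)
open import Relation.Nullary using (¬_)
open import Relation.Unary using (Pred; _≐_)

-- Reals are represented by Cauchy sequences of rationals.  Equality of
-- reals is _≃_, not propositional equality of representatives.

IsCauchy : (ℕ → ℚ) → Set
IsCauchy x =
  ∀ ε → 0ℚ ℚ.< ε → ∃[ N ] ∀ m n → N ℕ.≤ m → N ℕ.≤ n → ℚ.∣ x m ℚ.- x n ∣ ℚ.< ε

record ℝ : Set where
  constructor mkℝ
  field
    seq    : ℕ → ℚ
    cauchy : IsCauchy seq

open ℝ public

infix 4 _≃_ _<ᴿ_ _≤ᴿ_
infixl 6 _-ᴿ_

_≃_ : ℝ → ℝ → Set
x ≃ y =
  ∀ ε → 0ℚ ℚ.< ε → ∃[ N ] ∀ n → N ℕ.≤ n → ℚ.∣ seq x n ℚ.- seq y n ∣ ℚ.< ε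

-- The gap ε is uniform: a pointwise strict inequality is not enough in the limit.
_<ᴿ_ : ℝ → ℝ → Set
x <ᴿ y =
  ∃[ ε ] 0ℚ ℚ.< ε × (∃[ N ] ∀ n → N ℕ.≤ n → seq x n ℚ.+ ε ℚ.≤ seq y n)

_≤ᴿ_ : ℝ → ℝ → Set
x ≤ᴿ y = ¬ (y <ᴿ x)

fromℚ : ℚ → ℝ
fromℚ q = mkℝ (λ _ → q) λ ε 0<ε →
  0 , λ _ _ _ _ → subst (λ r → ℚ.∣ r ∣ ℚ.< ε) (sym (ℚ.+-inverseʳ q)) 0<ε

fromℕ : ℕ → ℝ
fromℕ n = fromℚ (ℤ.+ n ℚ./ 1)

private
  half+half : ∀ ε → ½ ℚ.* ε ℚ.+ ½ ℚ.* ε ≡ ε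
  half+half ε =
    trans (sym (ℚ.*-distribʳ-+ ε ½ ½)) (ℚ.*-identityˡ ε)

  half-pos : ∀ {ε} → 0ℚ ℚ.< ε → 0ℚ ℚ.< ½ ℚ.* ε
  half-pos {ε} 0<ε =
    subst (ℚ._< ½ ℚ.* ε) (ℚ.*-zeroʳ ½) (ℚ.*-monoʳ-<-pos ½ 0<ε)

  rearrange : ∀ a b c d →
              (a ℚ.- b) ℚ.- (c ℚ.- d) ≡ (a ℚ.- c) ℚ.- (b ℚ.- d)
  rearrange = solve 4 (λ a b c d →
    (a :- b) :- (c :- d) := (a :- c) :- (b :- d)) refl
    where open +-*-Solver

_-ᴿ_ : ℝ → ℝ → ℝ
x -ᴿ y = mkℝ (λ n → seq x n ℚ.- seq y n) isCauchy
  where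
  isCauchy : IsCauchy (λ n → seq x n ℚ.- seq y n)
  isCauchy ε 0<ε
    with cauchy x (½ ℚ.* ε) (half-pos 0<ε) | cauchy y (½ ℚ.* ε) (half-pos 0<ε)
  ... | M , x-close | N , y-close = M ⊔ N , close
    where
    open ℚ.≤-Reasoning
    close : ∀ m n → M ⊔ N ℕ.≤ m → M ⊔ N ℕ.≤ n →
            ℚ.∣ (seq x m ℚ.- seq y m) ℚ.- (seq x n ℚ.- seq y n) ∣ ℚ.< ε
    close m n p q = begin-strict
      ℚ.∣ (seq x m ℚ.- seq y m) ℚ.- (seq x n ℚ.- seq y n) ∣
        ≡⟨ cong ℚ.∣_∣ (rearrange (seq x m) (seq y m) (seq x n) (seq y n)) ⟩
      ℚ.∣ (seq x m ℚ.- seq x n) ℚ.- (seq y m ℚ.- seq y n) ∣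
        ≤⟨ ℚ.∣p-q∣≤∣p∣+∣q∣ (seq x m ℚ.- seq x n) (seq y m ℚ.- seq y n) ⟩
      ℚ.∣ seq x m ℚ.- seq x n ∣ ℚ.+ ℚ.∣ seq y m ℚ.- seq y n ∣
        <⟨ ℚ.+-mono-<
             (x-close m n (ℕ.m⊔n≤o⇒m≤o M N p) (ℕ.m⊔n≤o⇒m≤o M N q))
             (y-close m n (ℕ.m⊔n≤o⇒n≤o M N p) (ℕ.m⊔n≤o⇒n≤o M N q)) ⟩
      ½ ℚ.* ε ℚ.+ ½ ℚ.* ε
        ≡⟨ half+half ε ⟩
      ε ∎

-- The alphabet is Fin k.  Positions are counted from zero, so the first
-- position is Fin.zero; the word has suc m letters, hence is nonempty.
record TimedWord (k : ℕ) : Set where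
  field
    {m}        : ℕ
    σ          : Fin (suc m) → Fin k
    τ          : Fin (suc m) → ℝ
    starts-at0 : τ Fin.zero ≃ fromℕ 0
    increasing : ∀ (i : Fin m) → τ (inject₁ i) <ᴿ τ (Fin.suc i)

  Position : Set
  Position = Fin (suc m)

TimedLanguage : ℕ → Set₁
TimedLanguage k = Pred (TimedWord k) 0ℓ

data Bracket : Set where
  open′ closed : Bracket

data Interval : Set where
  bounded   : Bracket → ℕ → ℕ → Bracket → Interval
  unbounded : Bracket → ℕ → Interval

above : Bracket → ℕ → ℝ → Set
above open′  l x = fromℕ l <ᴿ x
above closed l x = fromℕ l ≤ᴿ x

below : Bracket → ℕ → ℝ → Set
below open′  u x = x <ᴿ fromℕ u
below closed u x = x ≤ᴿ fromℕ u

infix 4 _∈ᴵ_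

_∈ᴵ_ : ℝ → Interval → Set
x ∈ᴵ bounded b l u c = above b l x × below c u x
x ∈ᴵ unbounded b l   = above b l x

-- [0,0] is excluded by non-singularity; the empty [0,0) is not, which is harmless
-- for expressiveness.
Singular : Interval → Set
Singular I = ∃[ l ] I ≡ bounded closed l l closed

data Only∞ : Pred Interval 0ℓ where
  ⟨l,∞⟩ : ∀ b l → Only∞ (unbounded b l)

data Only0∞ : Pred Interval 0ℓ where
  [0,u⟩ : ∀ u c → ¬ Singular (bounded closed 0 u c) →
          Only0∞ (bounded closed 0 u c)
  ⟨l,∞⟩ : ∀ b l → Only0∞ (unbounded b l)

data Formula (𝓘 : Pred Interval 0ℓ) (k : ℕ) : Set where
  atom : Fin k → Formula 𝓘 k
  _∨′_ : Formula 𝓘 k → Formula 𝓘 k → Formula 𝓘 k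
  ¬′_  : Formula 𝓘 k → Formula 𝓘 k
  F P  : (I : Interval) → 𝓘 I → Formula 𝓘 k → Formula 𝓘 k

MITL[F∞,P∞] : ℕ → Set
MITL[F∞,P∞] = Formula Only∞

MITL[F0∞,P0∞] : ℕ → Set
MITL[F0∞,P0∞] = Formula Only0∞

module _ {𝓘 : Pred Interval 0ℓ} {k : ℕ} where

  infix 4 _,_⊨_

  _,_⊨_ : (ρ : TimedWord k) → TimedWord.Position ρ → Formula 𝓘 k → Set
  ρ , i ⊨ atom a   = TimedWord.σ ρ i ≡ a
  ρ , i ⊨ (φ ∨′ ψ) = (ρ , i ⊨ φ) ⊎ (ρ , i ⊨ ψ)
  ρ , i ⊨ (¬′ φ)   = ¬ (ρ , i ⊨ φ)
  ρ , i ⊨ F I _ φ  =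
    ∃[ j ] i Fin.< j × (TimedWord.τ ρ j -ᴿ TimedWord.τ ρ i) ∈ᴵ I × (ρ , j ⊨ φ)
  ρ , i ⊨ P I _ φ  =
    ∃[ j ] j Fin.< i × (TimedWord.τ ρ i -ᴿ TimedWord.τ ρ j) ∈ᴵ I × (ρ , j ⊨ φ)

  𝓛 : Formula 𝓘 k → TimedLanguage k
  𝓛 φ ρ = ρ , Fin.zero ⊨ φ

Definable[F∞,P∞] : ∀ {k} → TimedLanguage k → Set
Definable[F∞,P∞] {k} L = ∃ λ (φ : MITL[F∞,P∞] k) → L ≐ 𝓛 φ

Definable[F0∞,P0∞] : ∀ {k} → TimedLanguage k → Set
Definable[F0∞,P0∞] {k} L = ∃ λ (φ : MITL[F0∞,P0∞] k) → L ≐ 𝓛 φ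

{-# OPTIONS --safe #-}

-- Since every interval of a MITL[F∞,P∞] formula is unbounded, F I φ holds on an
-- initial segment of a word and P I φ on a final segment.  Hence, by repeated
-- bisection, a long enough word over a one-letter alphabet contains three
-- consecutive positions on which every subformula of a given formula is constant.
-- Moving the middle position of the three is then invisible to the formula: its
-- right neighbour can replace it as a witness for F, its left neighbour as a
-- witness for P.  In the word with time stamps 0, 1, 2, … such a move creates two
-- positions at distance less than 1, which F[0,∞) F[0,1) ⊤ detects.
module Submission where

open import Defs
open import Data.Fin as Fin using (Fin; toℕ; fromℕ<)
import Data.Fin.Properties as Fin
open import Data.Nat as ℕ using (ℕ; zero; suc; z≤n; s≤s)
import Data.Nat.Properties as ℕ
open import Data.Product using (_×_; _,_; proj₁; proj₂; ∃-syntax; Σ-syntax)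
open import Data.Rational as ℚ using (ℚ; 0ℚ; 1ℚ; ½)
import Data.Rational.Properties as ℚ
open import Data.Rational.Solver using (module +-*-Solver)
open import Data.Sum as Sum using ()
open import Data.Unit using (⊤; tt)
open import Function using (_∘_; id)
open import Level using (0ℓ)
open import Relation.Binary.PropositionalEquality
  using (_≡_; _≢_; refl; sym; trans; cong; subst; subst₂)
open import Relation.Nullary using (¬_; yes; no; contradiction)
open import Relation.Nullary.Decidable using (¬¬-excluded-middle; from-yes)
open import Relation.Unary using (Pred; _⊆_)

open TimedWord using (τ)

-- Inclusion of the fragments

module _ {𝓘 𝓙 : Pred Interval 0ℓ} (𝓘⊆𝓙 : 𝓘 ⊆ 𝓙) {k : ℕ} where

  weaken : Formula 𝓘 k → Formula 𝓙 k
  weaken (atom a)  = atom a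
  weaken (φ ∨′ ψ)  = weaken φ ∨′ weaken ψ
  weaken (¬′ φ)    = ¬′ weaken φ
  weaken (F I p φ) = F I (𝓘⊆𝓙 p) (weaken φ)
  weaken (P I p φ) = P I (𝓘⊆𝓙 p) (weaken φ)

  -- Both directions go in one induction, because negation exchanges them.
  weaken⁺ : ∀ φ {ρ : TimedWord k} {i} → ρ , i ⊨ φ → ρ , i ⊨ weaken φ
  weaken⁻ : ∀ φ {ρ : TimedWord k} {i} → ρ , i ⊨ weaken φ → ρ , i ⊨ φ

  weaken⁺ (atom a)  h                     = h
  weaken⁺ (φ ∨′ ψ)  h                     = Sum.map (weaken⁺ φ) (weaken⁺ ψ) h
  weaken⁺ (¬′ φ)    h                     = h ∘ weaken⁻ φ
  weaken⁺ (F I p φ) (j , i<j , d∈I , j⊨φ) = j , i<j , d∈I , weaken⁺ φ j⊨φ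
  weaken⁺ (P I p φ) (j , j<i , d∈I , j⊨φ) = j , j<i , d∈I , weaken⁺ φ j⊨φ

  weaken⁻ (atom a)  h                     = h
  weaken⁻ (φ ∨′ ψ)  h                     = Sum.map (weaken⁻ φ) (weaken⁻ ψ) h
  weaken⁻ (¬′ φ)    h                     = h ∘ weaken⁺ φ
  weaken⁻ (F I p φ) (j , i<j , d∈I , j⊨φ) = j , i<j , d∈I , weaken⁻ φ j⊨φ
  weaken⁻ (P I p φ) (j , j<i , d∈I , j⊨φ) = j , j<i , d∈I , weaken⁻ φ j⊨φ

Only∞⊆Only0∞ : Only∞ ⊆ Only0∞
Only∞⊆Only0∞ (⟨l,∞⟩ b l) = ⟨l,∞⟩ b l

-- Upward closed intervals and words with rational time stamps

∈ᴵ-mono : ∀ {I} → Only∞ I → ∀ x y → (∀ n → seq x n ℚ.≤ seq y n) → x ∈ᴵ I → y ∈ᴵ I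
∈ᴵ-mono (⟨l,∞⟩ open′ l) x y x≤y (ε , 0<ε , N , gap) =
  ε , 0<ε , N , λ n N≤n → ℚ.≤-trans (gap n N≤n) (x≤y n)
-- A closed bound is a negated strict inequality, so a gap of `y` below `l` is carried back to `x`.
∈ᴵ-mono (⟨l,∞⟩ closed l) x y x≤y l≤x (ε , 0<ε , N , gap) =
  l≤x (ε , 0<ε , N , λ n N≤n → ℚ.≤-trans (ℚ.+-monoˡ-≤ ε (x≤y n)) (gap n N≤n))

-- An infinite sequence, so that the word length can be chosen later, in terms of the formula.
record Clock : Set where
  field
    time     : ℕ → ℚ
    time-0   : time 0 ≡ 0ℚ
    time-suc : ∀ n → time n ℚ.< time (suc n)

  time-mono : ∀ {i j} → i ℕ.≤ j → time i ℚ.≤ time j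
  time-mono i≤j = mono (ℕ.≤⇒≤′ i≤j)
    where
    mono : ∀ {i j} → i ℕ.≤′ j → time i ℚ.≤ time j
    mono (ℕ.≤′-reflexive refl) = ℚ.≤-refl
    mono (ℕ.≤′-step i≤j)       = ℚ.≤-trans (mono i≤j) (ℚ.<⇒≤ (time-suc _))

open Clock

fromℚ-< : ∀ {p q} → p ℚ.< q → fromℚ p <ᴿ fromℚ q
fromℚ-< {p} {q} p<q =
  q ℚ.- p , subst (ℚ._< q ℚ.- p) (ℚ.+-inverseʳ p) (ℚ.+-monoˡ-< (ℚ.- p) p<q) ,
  0 , λ _ _ → ℚ.≤-reflexive (solve 2 (λ p q → p :+ (q :- p) := q) refl p q)
  where open +-*-Solver

word : Clock → ℕ → TimedWord 1
word c l = record
  { m          = l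
  ; σ          = λ _ → Fin.zero
  ; τ          = λ i → fromℚ (time c (toℕ i))
  ; starts-at0 = subst (λ q → fromℚ q ≃ fromℕ 0) (sym (time-0 c))
                   λ ε 0<ε → 0 , λ _ _ → 0<ε
  ; increasing = λ i → fromℚ-<
      (subst (λ n → time c n ℚ.< time c (suc (toℕ i))) (sym (Fin.toℕ-inject₁ i))
        (time-suc c (toℕ i)))
  }

distance-mono : ∀ {I} → Only∞ I → ∀ c c′ {l} (i j i′ j′ : Fin (suc l)) →
  time c (toℕ j) ℚ.≤ time c′ (toℕ j′) → time c′ (toℕ i′) ℚ.≤ time c (toℕ i) →
  (τ (word c l) j -ᴿ τ (word c l) i) ∈ᴵ I → (τ (word c′ l) j′ -ᴿ τ (word c′ l) i′) ∈ᴵ I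
distance-mono I∞ c c′ {l} i j i′ j′ j≤j′ i′≤i =
  ∈ᴵ-mono I∞ (τ (word c l) j -ᴿ τ (word c l) i) (τ (word c′ l) j′ -ᴿ τ (word c′ l) i′)
    λ _ → ℚ.+-mono-≤ j≤j′ (ℚ.neg-antimono-≤ i′≤i)

-- Stability of formulas on windows

Window : ∀ {l} → ℕ → ℕ → Pred (Fin (suc l)) 0ℓ
Window a w i = a ℕ.≤ toℕ i × toℕ i ℕ.≤ a ℕ.+ w

Window-⊆ : ∀ {l a w b v} → a ℕ.≤ b → b ℕ.+ v ℕ.≤ a ℕ.+ w → Window {l} b v ⊆ Window a w
Window-⊆ a≤b b+v≤a+w (b≤i , i≤b+v) = ℕ.≤-trans a≤b b≤i , ℕ.≤-trans i≤b+v b+v≤a+w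

ConstantOn : {A : Set} → Pred A 0ℓ → Pred A 0ℓ → Set
ConstantOn S Q = ∀ i j → S i → S j → Q i → Q j

module _ (ρ : TimedWord 1) where

  -- Constancy is demanded at temporal subformulas only: over one letter atoms are constant, and
  -- Boolean combinations inherit constancy.
  Stable : Pred (TimedWord.Position ρ) 0ℓ → MITL[F∞,P∞] 1 → Set
  Stable S (atom a)  = ⊤
  Stable S (φ ∨′ ψ)  = Stable S φ × Stable S ψ
  Stable S (¬′ φ)    = Stable S φ
  Stable S (F I p φ) = Stable S φ × ConstantOn S (λ i → ρ , i ⊨ F I p φ)
  Stable S (P I p φ) = Stable S φ × ConstantOn S (λ i → ρ , i ⊨ P I p φ)

  Stable-⊆ : ∀ {S T} → T ⊆ S → ∀ φ → Stable S φ → Stable T φ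
  Stable-⊆ T⊆S (atom a)  _       = tt
  Stable-⊆ T⊆S (φ ∨′ ψ)  (s , t) = Stable-⊆ T⊆S φ s , Stable-⊆ T⊆S ψ t
  Stable-⊆ T⊆S (¬′ φ)    s       = Stable-⊆ T⊆S φ s
  Stable-⊆ T⊆S (F I p φ) (s , c) =
    Stable-⊆ T⊆S φ s , λ i j i∈T j∈T → c i j (T⊆S i∈T) (T⊆S j∈T)
  Stable-⊆ T⊆S (P I p φ) (s , c) =
    Stable-⊆ T⊆S φ s , λ i j i∈T j∈T → c i j (T⊆S i∈T) (T⊆S j∈T)

singleton-letter : (a b : Fin 1) → a ≡ b
singleton-letter Fin.zero Fin.zero = refl

stable⇒constant : ∀ ρ {S} φ → Stable ρ S φ → ConstantOn S (λ i → ρ , i ⊨ φ)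
stable⇒constant ρ (atom a) _ i j _ _ _           = singleton-letter _ a
stable⇒constant ρ (φ ∨′ ψ) (s , t) i j i∈S j∈S   =
  Sum.map (stable⇒constant ρ φ s i j i∈S j∈S) (stable⇒constant ρ ψ t i j i∈S j∈S)
-- `ConstantOn` covers ordered pairs, so swapping `i` and `j` supplies the converse implication.
stable⇒constant ρ (¬′ φ) s i j i∈S j∈S           = _∘ stable⇒constant ρ φ s j i j∈S i∈S
stable⇒constant ρ (F I p φ) (_ , c)              = c
stable⇒constant ρ (P I p φ) (_ , c)              = c

module _ (c : Clock) {l : ℕ} where

  -- The same witness serves an earlier position: its distance only grows, and the interval is
  -- upward closed.
  F-antitone : ∀ {I p} (φ : MITL[F∞,P∞] 1) (i i′ : Fin (suc l)) → i Fin.≤ i′ →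
               word c l , i′ ⊨ F I p φ → word c l , i ⊨ F I p φ
  F-antitone {p = p} φ i i′ i≤i′ (j , i′<j , d∈I , j⊨φ) =
    j , ℕ.≤-<-trans i≤i′ i′<j ,
    distance-mono p c c i′ j i j ℚ.≤-refl (time-mono c i≤i′) d∈I , j⊨φ

  P-monotone : ∀ {I p} (φ : MITL[F∞,P∞] 1) (i i′ : Fin (suc l)) → i Fin.≤ i′ →
               word c l , i ⊨ P I p φ → word c l , i′ ⊨ P I p φ
  P-monotone {p = p} φ i i′ i≤i′ (j , j<i , d∈I , j⊨φ) =
    j , ℕ.<-≤-trans j<i i≤i′ ,
    distance-mono p c c j i j i′ (time-mono c i≤i′) ℚ.≤-refl d∈I , j⊨φ

-- Bisection

-- Double negated, because bisection asks whether Q holds at the midpoint.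
ConstantSubwindow : ∀ {l} → Pred (Fin (suc l)) 0ℓ → ℕ → ℕ → Set
ConstantSubwindow Q a w =
  ¬ ¬ (∃[ b ] a ℕ.≤ b × b ℕ.+ w ℕ.≤ a ℕ.+ (w ℕ.+ w) × ConstantOn (Window b w) Q)

module _ {l a w : ℕ} (a+w+w≤l : a ℕ.+ (w ℕ.+ w) ℕ.≤ l) where

  private
    a+w≤a+w+w : a ℕ.+ w ℕ.≤ a ℕ.+ (w ℕ.+ w)
    a+w≤a+w+w = ℕ.+-monoʳ-≤ a (ℕ.m≤m+n w w)

    a+w<1+l : a ℕ.+ w ℕ.< suc l
    a+w<1+l = s≤s (ℕ.≤-trans a+w≤a+w+w a+w+w≤l)

    mid : Fin (suc l)
    mid = fromℕ< a+w<1+l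

    mid≡a+w : toℕ mid ≡ a ℕ.+ w
    mid≡a+w = Fin.toℕ-fromℕ< a+w<1+l

    ≤mid : ∀ {i : Fin (suc l)} → toℕ i ℕ.≤ a ℕ.+ w → i Fin.≤ mid
    ≤mid = subst (_ ℕ.≤_) (sym mid≡a+w)

    mid≤ : ∀ {i : Fin (suc l)} → a ℕ.+ w ℕ.≤ toℕ i → mid Fin.≤ i
    mid≤ = subst (ℕ._≤ _) (sym mid≡a+w)

    left-half : ∀ {Q : Pred (Fin (suc l)) 0ℓ} →
                ConstantOn (Window a w) Q → ConstantSubwindow Q a w
    left-half const k = k (a , ℕ.≤-refl , a+w≤a+w+w , const)

    right-half : ∀ {Q : Pred (Fin (suc l)) 0ℓ} →
                 ConstantOn (Window (a ℕ.+ w) w) Q → ConstantSubwindow Q a w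
    right-half const k =
      k (a ℕ.+ w , ℕ.m≤m+n a w , ℕ.≤-reflexive (ℕ.+-assoc a w w) , const)

  -- If `Q` holds at the midpoint, it holds throughout the left half; otherwise it fails throughout
  -- the right half.
  antitone-subwindow : ∀ {Q : Pred (Fin (suc l)) 0ℓ} →
                       (∀ {i j} → i Fin.≤ j → Q j → Q i) → ConstantSubwindow Q a w
  antitone-subwindow {Q} antitone k = ¬¬-excluded-middle λ where
    (yes q) → left-half {Q} (λ _ j _ j∈ _ → antitone (≤mid {j} (proj₂ j∈)) q) k
    (no ¬q) → right-half {Q}
      (λ i _ i∈ _ q → contradiction (antitone (mid≤ {i} (proj₁ i∈)) q) ¬q) k

  monotone-subwindow : ∀ {Q : Pred (Fin (suc l)) 0ℓ} →
                       (∀ {i j} → i Fin.≤ j → Q i → Q j) → ConstantSubwindow Q a w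
  monotone-subwindow {Q} monotone k = ¬¬-excluded-middle λ where
    (yes q) → right-half {Q} (λ _ j _ j∈ _ → monotone (mid≤ {j} (proj₁ j∈)) q) k
    (no ¬q) → left-half {Q}
      (λ i _ i∈ _ q → contradiction (monotone (≤mid {i} (proj₂ i∈)) q) ¬q) k

-- The width to start from in order to end with `w`. Each temporal operator costs one halving. Its
-- argument is treated first, on a window still twice as wide.
width : MITL[F∞,P∞] 1 → ℕ → ℕ
width (atom a)  w = w
width (φ ∨′ ψ)  w = width φ (width ψ w)
width (¬′ φ)    w = width φ w
width (F I p φ) w = width φ (w ℕ.+ w)
width (P I p φ) w = width φ (w ℕ.+ w)

module _ (c : Clock) {l : ℕ} where

  stable-window : ∀ φ {a w} → a ℕ.+ width φ w ℕ.≤ l →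
    ¬ ¬ (∃[ b ] a ℕ.≤ b × b ℕ.+ w ℕ.≤ a ℕ.+ width φ w × Stable (word c l) (Window b w) φ)
  stable-window (atom _) _ k = k (_ , ℕ.≤-refl , ℕ.≤-refl , tt)
  stable-window (φ ∨′ ψ) fits k =
    stable-window φ fits λ where
      (b , a≤b , b-end , s) →
        stable-window ψ (ℕ.≤-trans b-end fits) λ where
          (d , b≤d , d-end , t) →
            k (d , ℕ.≤-trans a≤b b≤d , ℕ.≤-trans d-end b-end ,
               Stable-⊆ (word c l) (Window-⊆ b≤d d-end) φ s , t)
  stable-window (¬′ φ) = stable-window φ
  stable-window (F I p φ) fits k =
    stable-window φ fits λ where
      (b , a≤b , b-end , s) →
        antitone-subwindow (ℕ.≤-trans b-end fits) {λ i → word c l , i ⊨ F I p φ}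
            (λ {i} {j} → F-antitone c {p = p} φ i j) λ where
          (d , b≤d , d-end , const) →
            k (d , ℕ.≤-trans a≤b b≤d , ℕ.≤-trans d-end b-end ,
               Stable-⊆ (word c l) (Window-⊆ b≤d d-end) φ s , const)
  stable-window (P I p φ) fits k =
    stable-window φ fits λ where
      (b , a≤b , b-end , s) →
        monotone-subwindow (ℕ.≤-trans b-end fits) {λ i → word c l , i ⊨ P I p φ}
            (λ {i} {j} → P-monotone c {p = p} φ i j) λ where
          (d , b≤d , d-end , const) →
            k (d , ℕ.≤-trans a≤b b≤d , ℕ.≤-trans d-end b-end ,
               Stable-⊆ (word c l) (Window-⊆ b≤d d-end) φ s , const)

-- Three consecutive positions

module Neighbours {l n : ℕ} (n+2≤l : n ℕ.+ 2 ℕ.≤ l) where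

  position : ∀ {i} → i ℕ.≤ n ℕ.+ 2 → Fin (suc l)
  position i≤n+2 = fromℕ< (s≤s (ℕ.≤-trans i≤n+2 n+2≤l))

  toℕ-position : ∀ {i} (i≤n+2 : i ℕ.≤ n ℕ.+ 2) → toℕ (position i≤n+2) ≡ i
  toℕ-position i≤n+2 = Fin.toℕ-fromℕ< (s≤s (ℕ.≤-trans i≤n+2 n+2≤l))

  private
    1+n≤n+2 : suc n ℕ.≤ n ℕ.+ 2
    1+n≤n+2 = subst (suc n ℕ.≤_) (ℕ.+-comm 2 n) (ℕ.n≤1+n (suc n))

  left right : Fin (suc l)
  left  = position (ℕ.m≤m+n n 2)
  right = position {n ℕ.+ 2} ℕ.≤-refl

  left≡n : toℕ left ≡ n
  left≡n = toℕ-position (ℕ.m≤m+n n 2)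

  right≡2+n : toℕ right ≡ 2 ℕ.+ n
  right≡2+n = trans (toℕ-position {n ℕ.+ 2} ℕ.≤-refl) (ℕ.+-comm n 2)

  middle : Fin (suc l)
  middle = position 1+n≤n+2

  middle≡1+n : toℕ middle ≡ suc n
  middle≡1+n = toℕ-position 1+n≤n+2

  Near : Pred (Fin (suc l)) 0ℓ
  Near = Window n 2

  near : ∀ {i : Fin (suc l)} {o} → o ℕ.≤ 2 → toℕ i ≡ o ℕ.+ n → Near i
  near {i} {o} o≤2 i≡o+n =
    subst (n ℕ.≤_) (sym i≡o+n) (ℕ.m≤n+m n o) ,
    subst₂ ℕ._≤_ (sym i≡o+n) (ℕ.+-comm 2 n) (ℕ.+-monoˡ-≤ n o≤2)

  left∈ : Near left
  left∈ = near z≤n left≡n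

  right∈ : Near right
  right∈ = near ℕ.≤-refl right≡2+n

  middle∈ : ∀ {i} → toℕ i ≡ suc n → Near i
  middle∈ = near (s≤s z≤n)

  Unmoved : Pred (Fin (suc l)) 0ℓ
  Unmoved i = toℕ i ≢ suc n

  left-unmoved : Unmoved left
  left-unmoved eq = ℕ.1+n≢n (sym (trans (sym left≡n) eq))

  right-unmoved : Unmoved right
  right-unmoved eq = ℕ.1+n≢n (trans (sym right≡2+n) eq)

  left≤ : ∀ {i : Fin (suc l)} → toℕ i ≡ suc n → left Fin.≤ i
  left≤ i≡1+n = subst₂ ℕ._≤_ (sym left≡n) (sym i≡1+n) (ℕ.n≤1+n n)

  ≤right : ∀ {i : Fin (suc l)} → toℕ i ≡ suc n → i Fin.≤ right
  ≤right i≡1+n = subst₂ ℕ._≤_ (sym i≡1+n) (sym right≡2+n) (ℕ.n≤1+n (suc n))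

  module _ {Q : Pred (Fin (suc l)) 0ℓ} (const : ConstantOn Near Q) where

    -- Only the middle position needs replacing, and its right neighbour does it. Going up suits
    -- `F`: a later witness is farther away.
    avoid-upwards : ∀ i → Q i → ∃[ j ] i Fin.≤ j × Unmoved j × Q j
    avoid-upwards i q with toℕ i ℕ.≟ suc n
    ... | no  i≢ = i , ℕ.≤-refl , i≢ , q
    ... | yes i≡ =
      right , ≤right {i} i≡ , right-unmoved , const i right (middle∈ {i} i≡) right∈ q

    avoid-downwards : ∀ i → Q i → ∃[ j ] j Fin.≤ i × Unmoved j × Q j
    avoid-downwards i q with toℕ i ℕ.≟ suc n
    ... | no  i≢ = i , ℕ.≤-refl , i≢ , q
    ... | yes i≡ =
      left , left≤ {i} i≡ , left-unmoved , const i left (middle∈ {i} i≡) left∈ q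

    -- The counterpart of `avoid-upwards` for a goal: constancy carries `Q` back from the right
    -- neighbour to the middle.
    from-above : ∀ i → (∀ j → i Fin.≤ j → Unmoved j → Q j) → Q i
    from-above i h with toℕ i ℕ.≟ suc n
    ... | no  i≢ = h i ℕ.≤-refl i≢
    ... | yes i≡ = const right i right∈ (middle∈ {i} i≡) (h right (≤right {i} i≡) right-unmoved)

    from-below : ∀ i → (∀ j → j Fin.≤ i → Unmoved j → Q j) → Q i
    from-below i h with toℕ i ℕ.≟ suc n
    ... | no  i≢ = h i ℕ.≤-refl i≢
    ... | yes i≡ = const left i left∈ (middle∈ {i} i≡) (h left (left≤ {i} i≡) left-unmoved)

-- Invisibility of moving the middle position

module _ (c c′ : Clock) {l n : ℕ} (n+2≤l : n ℕ.+ 2 ℕ.≤ l)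
         (agree : ∀ i → i ≢ suc n → time c i ≡ time c′ i) where

  open Neighbours n+2≤l

  private
    -- The comparison stays within one clock until the unmoved position, where the clocks agree and
    -- can be exchanged.
    c≤c′ : ∀ {i j : Fin (suc l)} → Unmoved j → i Fin.≤ j → time c (toℕ i) ℚ.≤ time c′ (toℕ j)
    c≤c′ j-unmoved i≤j = ℚ.≤-trans (time-mono c i≤j) (ℚ.≤-reflexive (agree _ j-unmoved))

    c′≤c : ∀ {i j : Fin (suc l)} → Unmoved j → i Fin.≤ j → time c′ (toℕ i) ℚ.≤ time c (toℕ j)
    c′≤c j-unmoved i≤j = ℚ.≤-trans (time-mono c′ i≤j) (ℚ.≤-reflexive (sym (agree _ j-unmoved)))

    c≥c′ : ∀ {i j : Fin (suc l)} → Unmoved j → j Fin.≤ i → time c′ (toℕ j) ℚ.≤ time c (toℕ i)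
    c≥c′ j-unmoved j≤i = ℚ.≤-trans (ℚ.≤-reflexive (sym (agree _ j-unmoved))) (time-mono c j≤i)

    c′≥c : ∀ {i j : Fin (suc l)} → Unmoved j → j Fin.≤ i → time c (toℕ j) ℚ.≤ time c′ (toℕ i)
    c′≥c j-unmoved j≤i = ℚ.≤-trans (ℚ.≤-reflexive (agree _ j-unmoved)) (time-mono c′ j≤i)

  -- Stability is known for the word of `c` only. Hence `move⁺` uses constancy before changing the
  -- word, whereas `move⁻` first brings the witness back to `c` and then applies constancy to it and
  -- to the goal.
  move⁺ : ∀ φ → Stable (word c l) Near φ → ∀ i → word c l , i ⊨ φ → word c′ l , i ⊨ φ
  move⁻ : ∀ φ → Stable (word c l) Near φ → ∀ i → word c′ l , i ⊨ φ → word c l , i ⊨ φ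

  move⁺ (atom a) _ i h = h
  move⁺ (φ ∨′ ψ) (s , t) i = Sum.map (move⁺ φ s i) (move⁺ ψ t i)
  move⁺ (¬′ φ) s i = _∘ move⁻ φ s i
  move⁺ (F I p φ) (s , const) i h =
    -- Constancy of the whole formula shifts the starting point, that of `φ` the witness. In the new
    -- word `j′` is at least as far from `i` as `j` was from `i′` in the old one.
    let i′ , i≤i′ , i′-unmoved , j , i′<j , d∈I , j⊨φ = avoid-upwards const i h
        j′ , j≤j′ , j′-unmoved , j′⊨φ = avoid-upwards (stable⇒constant (word c l) φ s) j j⊨φ
    in j′ , ℕ.≤-<-trans i≤i′ (ℕ.<-≤-trans i′<j j≤j′) ,
       distance-mono p c c′ i′ j i j′
         (c≤c′ {j} {j′} j′-unmoved j≤j′)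
         (c′≤c {i} {i′} i′-unmoved i≤i′) d∈I ,
       move⁺ φ s j′ j′⊨φ
  move⁺ (P I p φ) (s , const) i h =
    let i′ , i′≤i , i′-unmoved , j , j<i′ , d∈I , j⊨φ = avoid-downwards const i h
        j′ , j′≤j , j′-unmoved , j′⊨φ = avoid-downwards (stable⇒constant (word c l) φ s) j j⊨φ
    in j′ , ℕ.≤-<-trans j′≤j (ℕ.<-≤-trans j<i′ i′≤i) ,
       distance-mono p c c′ j i′ j′ i
         (c′≥c {i} {i′} i′-unmoved i′≤i)
         (c≥c′ {j} {j′} j′-unmoved j′≤j) d∈I ,
       move⁺ φ s j′ j′⊨φ

  move⁻ (atom a) _ i h = h
  move⁻ (φ ∨′ ψ) (s , t) i = Sum.map (move⁻ φ s i) (move⁻ ψ t i)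
  move⁻ (¬′ φ) s i = _∘ move⁺ φ s i
  move⁻ (F I p φ) (s , const) i (j , i<j , d∈I , j⊨φ) =
    let j′ , j≤j′ , j′-unmoved , j′⊨φ = avoid-upwards (stable⇒constant (word c l) φ s) j
                                       (move⁻ φ s j j⊨φ)
    -- The starting point is shifted down, since an earlier start also increases the distance.
    in from-below const i λ i′ i′≤i i′-unmoved →
      j′ , ℕ.≤-<-trans i′≤i (ℕ.<-≤-trans i<j j≤j′) ,
      distance-mono p c′ c i j i′ j′
         (c′≤c {j} {j′} j′-unmoved j≤j′)
         (c′≥c {i} {i′} i′-unmoved i′≤i) d∈I ,
      j′⊨φ
  move⁻ (P I p φ) (s , const) i (j , j<i , d∈I , j⊨φ) =
    let j′ , j′≤j , j′-unmoved , j′⊨φ = avoid-downwards (stable⇒constant (word c l) φ s) j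
                                       (move⁻ φ s j j⊨φ)
    in from-above const i λ i′ i≤i′ i′-unmoved →
      j′ , ℕ.≤-<-trans j′≤j (ℕ.<-≤-trans j<i i≤i′) ,
      distance-mono p c′ c j i j′ i′
         (c′≤c {i} {i′} i′-unmoved i≤i′)
         (c′≥c {j} {j′} j′-unmoved j′≤j) d∈I ,
      j′⊨φ

-- The separating language

0<½ : 0ℚ ℚ.< ½
0<½ = from-yes (0ℚ ℚ.<? ½)

½<1 : ½ ℚ.< 1ℚ
½<1 = from-yes (½ ℚ.<? 1ℚ)

p<p+q : ∀ p {q} → 0ℚ ℚ.< q → p ℚ.< p ℚ.+ q
p<p+q p {q} 0<q = subst (ℚ._< p ℚ.+ q) (ℚ.+-identityʳ p) (ℚ.+-monoʳ-< p 0<q)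

ticks : ℕ → ℚ
ticks zero    = 0ℚ
ticks (suc n) = ticks n ℚ.+ 1ℚ

ticks-suc : ∀ n → ticks n ℚ.< ticks (suc n)
ticks-suc n = p<p+q (ticks n) (ℚ.<-trans 0<½ ½<1)

regular : Clock
regular = record { time = ticks ; time-0 = refl ; time-suc = ticks-suc }

-- Half a tick is less than the spacing, so the order survives, while the distance to the
-- predecessor drops below 1.
advanced-ticks : ℕ → ℕ → ℚ
advanced-ticks e n with n ℕ.≟ e
... | yes _ = ticks n ℚ.- ½
... | no  _ = ticks n

advanced-agrees : ∀ e n → n ≢ e → ticks n ≡ advanced-ticks e n
advanced-agrees e n n≢e with n ℕ.≟ e
... | yes n≡e = contradiction n≡e n≢e
... | no  _   = refl

advanced-moved : ∀ n → advanced-ticks (suc n) (suc n) ≡ ticks n ℚ.+ ½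
advanced-moved n with suc n ℕ.≟ suc n
... | yes _  = ℚ.+-assoc (ticks n) 1ℚ (ℚ.- ½)
... | no n≢n = contradiction refl n≢n

advanced-suc : ∀ e n → advanced-ticks e n ℚ.< advanced-ticks e (suc n)
advanced-suc e n with n ℕ.≟ e | suc n ℕ.≟ e
... | yes n≡e | yes 1+n≡e = contradiction (trans 1+n≡e (sym n≡e)) ℕ.1+n≢n
... | yes _   | no  _     =
  ℚ.<-trans (ℚ.+-monoʳ-< (ticks n) (from-yes (ℚ.- ½ ℚ.<? 0ℚ)))
    (subst (ℚ._< ticks (suc n)) (sym (ℚ.+-identityʳ (ticks n))) (ticks-suc n))
... | no  _   | yes _     =
  subst (ticks n ℚ.<_) (sym (ℚ.+-assoc (ticks n) 1ℚ (ℚ.- ½))) (p<p+q (ticks n) 0<½)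
... | no  _   | no  _     = ticks-suc n

advanced : ℕ → Clock
advanced n = record
  { time     = advanced-ticks (suc n)
  -- The moved index is a successor, so time 0 is untouched.
  ; time-0   = refl
  ; time-suc = advanced-suc (suc n)
  }

[0,1⟩-admissible : Only0∞ (bounded closed 0 1 open′)
[0,1⟩-admissible = [0,u⟩ 1 open′ λ ()

close-pair : MITL[F0∞,P0∞] 1
close-pair = F (unbounded closed 0) (⟨l,∞⟩ closed 0)
               (F (bounded closed 0 1 open′) [0,1⟩-admissible (atom Fin.zero))

nonneg-distance : ∀ {p q} → q ℚ.≤ p → fromℕ 0 ≤ᴿ (fromℚ p -ᴿ fromℚ q)
nonneg-distance {p} {q} q≤p (ε , 0<ε , N , gap) =
  ℚ.<-irrefl refl (ℚ.<-≤-trans (ℚ.≤-<-trans 0≤p-q (p<p+q (p ℚ.- q) 0<ε)) (gap N ℕ.≤-refl))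
  where
  0≤p-q : 0ℚ ℚ.≤ p ℚ.- q
  0≤p-q = subst (ℚ._≤ p ℚ.- q) (ℚ.+-inverseʳ q) (ℚ.+-monoˡ-≤ (ℚ.- q) q≤p)

regular-⊭close-pair : ∀ l → ¬ (word regular l , Fin.zero ⊨ close-pair)
regular-⊭close-pair l (i , _ , _ , j , i<j , (_ , ε , 0<ε , N , gap) , _) =
  ℚ.<-irrefl refl
    (ℚ.<-≤-trans (ℚ.≤-<-trans 1≤d (p<p+q d 0<ε)) (gap N ℕ.≤-refl))
  where
  open +-*-Solver
  d = ticks (toℕ j) ℚ.- ticks (toℕ i)
  1≤d : 1ℚ ℚ.≤ d
  1≤d = subst (ℚ._≤ d)
    (solve 1 (λ t → (t :+ con 1ℚ) :- t := con 1ℚ) refl (ticks (toℕ i)))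
    -- `i<j` unfolds to `suc i ≤ j`, so monotonicity already gives a full tick.
    (ℚ.+-monoˡ-≤ (ℚ.- ticks (toℕ i)) (time-mono regular i<j))

advanced-⊨close-pair : ∀ {l n} → 0 ℕ.< n → n ℕ.+ 2 ℕ.≤ l →
                       word (advanced n) l , Fin.zero ⊨ close-pair
advanced-⊨close-pair {l} {n} 0<n n+2≤l =
  -- The outer `F` is strict, so the pair must start after the first position; this is where `0<n`
  -- enters.
  left , subst (0 ℕ.<_) (sym left≡n) 0<n ,
  nonneg-distance (time-mono c {0} {toℕ left} z≤n) ,
  middle , left<middle ,
  (nonneg-distance (time-mono c (ℕ.<⇒≤ left<middle)) ,
   -- The distance is exactly ½, which leaves a gap of ½ below 1.
   ½ , 0<½ , 0 , λ _ _ → ℚ.≤-reflexive d+½≡1) ,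
  refl
  where
  open Neighbours n+2≤l
  open +-*-Solver
  c = advanced n
  left<middle : left Fin.< middle
  left<middle = subst₂ ℕ._<_ (sym left≡n) (sym middle≡1+n) ℕ.≤-refl
  time-left : time c (toℕ left) ≡ ticks n
  time-left = trans (cong (time c) left≡n) (sym (advanced-agrees (suc n) n (ℕ.1+n≢n ∘ sym)))
  time-middle : time c (toℕ middle) ≡ ticks n ℚ.+ ½
  time-middle = trans (cong (time c) middle≡1+n) (advanced-moved n)
  d+½≡1 : (time c (toℕ middle) ℚ.- time c (toℕ left)) ℚ.+ ½ ≡ 1ℚ
  d+½≡1 rewrite time-left | time-middle =
    solve 1 (λ t → ((t :+ con ½) :- t) :+ con ½ := con 1ℚ) refl (ticks n)

close-pair-not-definable : ¬ Definable[F∞,P∞] (𝓛 close-pair)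
close-pair-not-definable (φ , L⊆φ , φ⊆L) =
  -- Start 1 keeps the pair off the first position, width 2 gives three positions, and `ℕ.≤-refl`
  -- fixes the last index of the word as `1 + width φ 2`. The double negation is harmless, as the
  -- goal is a contradiction.
  stable-window regular φ {1} {2} ℕ.≤-refl λ where
    (n , 0<n , n+2≤l , s) →
      regular-⊭close-pair _ (φ⊆L
        (move⁻ regular (advanced n) n+2≤l (advanced-agrees (suc n)) φ s Fin.zero
          (L⊆φ (advanced-⊨close-pair 0<n n+2≤l))))

theorem10 : (∀ (k : ℕ) (L : TimedLanguage k) → Definable[F∞,P∞] L → Definable[F0∞,P0∞] L)
    × (∃[ k ] Σ[ L ∈ TimedLanguage k ] (Definable[F0∞,P0∞] L × ¬ Definable[F∞,P∞] L))
theorem10 =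
  (λ k L (φ , L⊆φ , φ⊆L) →
    weaken Only∞⊆Only0∞ φ , weaken⁺ Only∞⊆Only0∞ φ ∘ L⊆φ , φ⊆L ∘ weaken⁻ Only∞⊆Only0∞ φ) ,
  1 , 𝓛 close-pair , (close-pair , id , id) , close-pair-not-definable
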